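{- Let $n\ge 0$ be an integer and let $Z_n$ be the number of zeros of a random lattice path $P_n$ of length $n$ (chosen according to the model in the context). Then $$\mathbb{E}(Z_n)=H^{\mathrm{odd}}_{n+1}.$$
   Context: $H^{\mathrm{odd}}_n=\sum_{1\le m\le n,\ m\text{ odd}}\frac1m$. Random path model: for an integer $n\ge0$, a random path $P_n$ on the lattice $\mathbb{Z}^2$ with steps $(1,+1)$ and $(1,-1)$, ending in $(n,0)$, is chosen as follows. First choose a starting point $(0,S)$ with $S$ uniformly distributed in $\{ -n,-n+2,\dots,n-2,n\}$. Then choose a path uniformly at random among all paths from $(0,S)$ to $(n,0)$. A zero of $P_n$ is a lattice point $(x,0)\in P_n$ visited by the path (including the starting point if $S=0$ and the end point $(n,0)$). -}

module Defs where

open import Data.Fin using (Fin; zero; suc; toℕ)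
open import Data.Integer using (ℤ; +_; 0ℤ; 1ℤ; -1ℤ) renaming (_+_ to _+ᶻ_; -_ to -ᶻ_)
open import Data.Integer.Properties using () renaming (_≟_ to _≟ᶻ_)
open import Data.Integer.Tactic.RingSolver using (solve-∀)
open import Data.List using (List; []; _∷_; [_]; _++_; allFin; concatMap; filter; foldr; length; map; upTo)
open import Data.List.Membership.Propositional using (_∈_)
open import Data.List.Membership.Propositional.Properties using (∈-++⁺ˡ; ∈-++⁺ʳ; ∈-filter⁺; ∈-map⁺)
open import Data.List.Relation.Unary.Any using (here)
open import Data.Nat using (ℕ; zero; suc; NonZero; _*_)
open import Data.Nat.Divisibility using (_∣?_)
open import Data.Nat.Properties using (*-suc)
open import Data.Product using (_×_; _,_; ∃; proj₁; proj₂)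
open import Data.Product.Properties using (≡-dec)
open import Data.Rational using (ℚ; 0ℚ; _/_) renaming (_+_ to _+ꟴ_; _*_ to _*ꟴ_)
open import Data.Vec using (Vec; []; _∷_; count; last)
open import Relation.Binary.Definitions using (DecidableEquality)
open import Relation.Binary.PropositionalEquality using (_≡_; refl; trans; cong; cong₂)
open import Relation.Nullary.Decidable using (¬?)

sumℚ : List ℚ → ℚ
sumℚ = foldr _+ꟴ_ 0ℚ

-- The index i stands for the summand with m = suc i, so 1 ≤ m ≤ n.
H-odd : ℕ → ℚ
H-odd n = sumℚ (map (λ i → + 1 / suc i) (filter (λ i → ¬? (2 ∣? suc i)) (upTo n)))

-- A finitely supported distribution, as a list of outcomes with their weights.
Dist : Set → Set
Dist A = List (A × ℚ)

uniform : {A : Set} (xs : List A) .{{_ : NonZero (length xs)}} → Dist A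
uniform xs = map (λ x → x , + 1 / length xs) xs

-- Two-stage choice: draw a from the first distribution, then draw from f a.
infixl 1 _>>=_
_>>=_ : {A B : Set} → Dist A → (A → Dist B) → Dist B
d >>= f = concatMap (λ (a , w) → map (λ (b , v) → b , w *ꟴ v) (f a)) d

𝔼 : {A : Set} → Dist A → (A → ℚ) → ℚ
𝔼 d X = sumℚ (map (λ (a , w) → w *ꟴ X a) d)

Point : Set
Point = ℤ × ℤ

_≟ᵖ_ : DecidableEquality Point
_≟ᵖ_ = ≡-dec _≟ᶻ_ _≟ᶻ_

up down : Point → Point
up   (x , y) = x +ᶻ 1ℤ , y +ᶻ 1ℤ
down (x , y) = x +ᶻ 1ℤ , y +ᶻ -1ℤ

-- A path with n steps is represented by the n + 1 lattice points it visits, in order.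
Path : ℕ → Set
Path n = Vec Point (suc n)

-- All paths with n steps starting at a point, each listed once.
pathsFrom : (n : ℕ) → Point → List (Path n)
pathsFrom zero    p = [ p ∷ [] ]
pathsFrom (suc n) p = map (p ∷_) (pathsFrom n (up p) ++ pathsFrom n (down p))

pathsBetween : (n : ℕ) → Point → Point → List (Path n)
pathsBetween n p q = filter (λ P → last P ≟ᵖ q) (pathsFrom n p)

-- The points of a path have distinct abscissae, so counting positions counts points.
zeros : {n : ℕ} → Path n → ℕ
zeros = count (λ p → proj₂ p ≟ᶻ 0ℤ)

-- As k ranges over 0, …, n, this ranges over -n, -n+2, …, n-2, n.
startHeight : (n : ℕ) → Fin (suc n) → ℤ
startHeight n k = -ᶻ (+ n) +ᶻ + (2 * toℕ k)

paths : (n : ℕ) → Fin (suc n) → List (Path n)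
paths n k = pathsBetween n (0ℤ , startHeight n k) (+ n , 0ℤ)

-- Every admissible starting point is joined to the end point by some path,
-- so the uniform choice among these paths makes sense.
private
  reach : ∀ n (k : Fin (suc n)) x y → y ≡ startHeight n k →
          ∃ λ P → P ∈ pathsFrom n (x , y) × last P ≡ (x +ᶻ + n , 0ℤ)
  reach zero zero x y eq = _ , here refl , cong₂ _,_ (lemma x) eq
    where
    lemma : ∀ x → x ≡ x +ᶻ 0ℤ
    lemma = solve-∀
  reach (suc n) zero x y eq =
    let P , P∈ , e = reach n zero (x +ᶻ 1ℤ) (y +ᶻ 1ℤ) (trans (cong (_+ᶻ 1ℤ) eq) (lemma₁ (+ n)))
    in  _ , ∈-map⁺ _ (∈-++⁺ˡ P∈) , trans e (cong (_, 0ℤ) (lemma₂ x (+ n)))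
    where
    lemma₁ : ∀ m → -ᶻ (1ℤ +ᶻ m) +ᶻ 0ℤ +ᶻ 1ℤ ≡ -ᶻ m +ᶻ 0ℤ
    lemma₁ = solve-∀
    lemma₂ : ∀ x m → x +ᶻ 1ℤ +ᶻ m ≡ x +ᶻ (1ℤ +ᶻ m)
    lemma₂ = solve-∀
  reach (suc n) (suc k) x y eq =
    let eq₁ = trans eq (cong (λ j → -ᶻ (+ suc n) +ᶻ + j) (*-suc 2 (toℕ k)))
        eq₂ = trans (cong (_+ᶻ -1ℤ) eq₁) (lemma₁ (+ n) (+ (2 * toℕ k)))
        P , P∈ , e = reach n k (x +ᶻ 1ℤ) (y +ᶻ -1ℤ) eq₂
    in  _ , ∈-map⁺ _ (∈-++⁺ʳ (pathsFrom n (up (x , y))) P∈) , trans e (cong (_, 0ℤ) (lemma₂ x (+ n)))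
    where
    lemma₁ : ∀ m j → -ᶻ (1ℤ +ᶻ m) +ᶻ (+ 2 +ᶻ j) +ᶻ -1ℤ ≡ -ᶻ m +ᶻ j
    lemma₁ = solve-∀
    lemma₂ : ∀ x m → x +ᶻ 1ℤ +ᶻ m ≡ x +ᶻ (1ℤ +ᶻ m)
    lemma₂ = solve-∀

  ∈⇒nonZero : {A : Set} {x : A} {xs : List A} → x ∈ xs → NonZero (length xs)
  ∈⇒nonZero {xs = _ ∷ _} _ = _

  0+ : ∀ i → 0ℤ +ᶻ i ≡ i
  0+ = solve-∀

paths-nonZero : ∀ n k → NonZero (length (paths n k))
paths-nonZero n k =
  let P , P∈ , e = reach n k 0ℤ (startHeight n k) refl
  in  ∈⇒nonZero (∈-filter⁺ (λ P → last P ≟ᵖ (+ n , 0ℤ)) P∈ (trans e (cong (_, 0ℤ) (0+ (+ n)))))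

randomPath : (n : ℕ) → Dist (Path n)
randomPath n = uniform (allFin (suc n)) >>= λ k → uniform (paths n k) {{paths-nonZero n k}}

{-# OPTIONS --safe #-}

-- Encode a starting height as 2k - n. Then C(n, k) paths reach (n, 0), and the first
-- step of a path leads to k with weight (n - k)/n or to k - 1 with weight k/n. So the
-- mean number e(n, k) of zeros satisfies
--   e(n, k) = ((n - k) e(n-1, k) + k e(n-1, k-1)) / n + [2k = n].
-- Summing over 0 ≤ k ≤ n, each e(n-1, k) has total weight (n + 1)/n, hence after division
-- by n + 1 one gets E(Z_n) = E(Z_{n-1}) + [n even]/(n + 1).
module Submission where

open import Defs
open import Data.Nat using (ℕ; zero; suc; pred; _∸_; _<_; NonZero)
  renaming (_+_ to _+ⁿ_; _*_ to _*ⁿ_)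
import Data.Nat.Properties as ℕ
open import Data.Nat.Combinatorics using (_C_; nC1≡n; nCk+nC[k+1]≡[n+1]C[k+1]; k>n⇒nCk≡0)
open import Data.Nat.Divisibility using (_∣_; _∣?_; n∣n; ∣m+n∣m⇒∣n; ∣m∣n⇒∣m+n; ∣1⇒≡1)
open import Data.Integer using (ℤ; +_; -[1+_]; 0ℤ; 1ℤ; -1ℤ)
  renaming (_+_ to _+ᶻ_; _*_ to _*ᶻ_; -_ to -ᶻ_)
import Data.Integer.Properties as ℤ
import Data.Integer.Tactic.RingSolver as ℤ-solver
open import Data.Rational using (ℚ; 0ℚ; 1ℚ; _/_; _+_; _*_; toℚᵘ; fromℚᵘ)
import Data.Rational.Properties as ℚ
open import Data.Rational.Unnormalised as ℚᵘ using (mkℚᵘ; *≡*)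
import Data.Rational.Unnormalised.Properties as ℚᵘ
open import Data.Rational.Solver using (module +-*-Solver)
open import Data.Bool using (true; false; if_then_else_)
open import Data.Fin using (toℕ)
open import Data.Product using (_×_; _,_; proj₂)
open import Data.Sum using (_⊎_; inj₁; inj₂)
open import Data.Vec using ([]; _∷_; last)
open import Data.List using (List; []; _∷_; _++_; map; filter; length; upTo; applyUpTo; allFin; tabulate)
open import Data.List.Properties
  using (map-cong; map-∘; map-cong-local; map-upTo; map-tabulate;
         upTo-∷ʳ; length-tabulate; length-++; length-map; filter-++; filter-accept; filter-reject)
open import Data.List.Relation.Unary.All as All using ()
open import Data.List.Relation.Unary.All.Properties using (all-upTo)
open import Function using (_∘_; id)
open import Relation.Nullary using (¬_; ¬?; yes; no; does; contradiction)
open import Relation.Unary using (Pred; Decidable)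
open import Relation.Binary.PropositionalEquality
  using (_≡_; _≢_; _≗_; refl; sym; trans; cong; cong₂; module ≡-Reasoning)

open +-*-Solver using (solve; _:+_; _:*_; _:=_; con)
open ≡-Reasoning

private
  variable
    A B : Set

-- Rational arithmetic and the embedding of the naturals.

-- Sums in `ℚ` are normalised by a gcd, which is stuck on variables; on unnormalised fractions an
-- equation is a cross-multiplication in `ℤ`.
fromℚᵘ-+ : ∀ p q r → p ℚᵘ.+ q ℚᵘ.≃ r → fromℚᵘ p + fromℚᵘ q ≡ fromℚᵘ r
fromℚᵘ-+ p q r p+q≃r = begin
  fromℚᵘ p + fromℚᵘ q                           ≡⟨ ℚ.fromℚᵘ-toℚᵘ _ ⟨
  fromℚᵘ (toℚᵘ (fromℚᵘ p + fromℚᵘ q))           ≡⟨ ℚ.fromℚᵘ-cong (ℚ.toℚᵘ-homo-+ (fromℚᵘ p) (fromℚᵘ q)) ⟩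
  fromℚᵘ (toℚᵘ (fromℚᵘ p) ℚᵘ.+ toℚᵘ (fromℚᵘ q)) ≡⟨ ℚ.fromℚᵘ-cong (ℚᵘ.+-cong (ℚ.toℚᵘ-fromℚᵘ p) (ℚ.toℚᵘ-fromℚᵘ q)) ⟩
  fromℚᵘ (p ℚᵘ.+ q)                             ≡⟨ ℚ.fromℚᵘ-cong p+q≃r ⟩
  fromℚᵘ r                                      ∎

fromℚᵘ-* : ∀ p q r → p ℚᵘ.* q ℚᵘ.≃ r → fromℚᵘ p * fromℚᵘ q ≡ fromℚᵘ r
fromℚᵘ-* p q r p*q≃r = begin
  fromℚᵘ p * fromℚᵘ q                           ≡⟨ ℚ.fromℚᵘ-toℚᵘ _ ⟨
  fromℚᵘ (toℚᵘ (fromℚᵘ p * fromℚᵘ q))           ≡⟨ ℚ.fromℚᵘ-cong (ℚ.toℚᵘ-homo-* (fromℚᵘ p) (fromℚᵘ q)) ⟩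
  fromℚᵘ (toℚᵘ (fromℚᵘ p) ℚᵘ.* toℚᵘ (fromℚᵘ q)) ≡⟨ ℚ.fromℚᵘ-cong (ℚᵘ.*-cong (ℚ.toℚᵘ-fromℚᵘ p) (ℚ.toℚᵘ-fromℚᵘ q)) ⟩
  fromℚᵘ (p ℚᵘ.* q)                             ≡⟨ ℚ.fromℚᵘ-cong p*q≃r ⟩
  fromℚᵘ r                                      ∎

-- With this spelling `ι ∘ zeros` is definitionally the random variable of `theorem4p1`.
ι : ℕ → ℚ
ι n = + n / 1

ι-+ : ∀ m n → ι (m +ⁿ n) ≡ ι m + ι n
ι-+ m n = sym (fromℚᵘ-+ (mkℚᵘ (+ m) 0) (mkℚᵘ (+ n) 0) (mkℚᵘ (+ (m +ⁿ n)) 0) (*≡* (cross (+ m) (+ n))))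
  where
  cross : ∀ m n → (m *ᶻ 1ℤ +ᶻ n *ᶻ 1ℤ) *ᶻ 1ℤ ≡ (m +ᶻ n) *ᶻ 1ℤ
  cross = ℤ-solver.solve-∀

ι-* : ∀ m n → ι (m *ⁿ n) ≡ ι m * ι n
ι-* m n = sym (fromℚᵘ-* (mkℚᵘ (+ m) 0) (mkℚᵘ (+ n) 0) (mkℚᵘ (+ (m *ⁿ n)) 0)
  (*≡* (cong (_*ᶻ 1ℤ) (sym (ℤ.pos-* m n)))))

1/n*n≡1 : ∀ n .{{_ : NonZero n}} → (+ 1 / n) * ι n ≡ 1ℚ
1/n*n≡1 n@(suc n-1) = fromℚᵘ-* (mkℚᵘ 1ℤ n-1) (mkℚᵘ (+ n) 0) (mkℚᵘ 1ℤ 0) (*≡* (cross (+ n)))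
  where
  cross : ∀ n → 1ℤ *ᶻ n *ᶻ 1ℤ ≡ 1ℤ *ᶻ (n *ᶻ 1ℤ)
  cross = ℤ-solver.solve-∀

-- Finite sums over lists.

∑ : List A → (A → ℚ) → ℚ
∑ xs f = sumℚ (map f xs)

∑-cong : ∀ {f g : A → ℚ} → f ≗ g → ∀ xs → ∑ xs f ≡ ∑ xs g
∑-cong f≗g xs = cong sumℚ (map-cong f≗g xs)

∑-map : ∀ (h : A → B) (f : B → ℚ) xs → ∑ (map h xs) f ≡ ∑ xs (f ∘ h)
∑-map h f xs = cong sumℚ (sym (map-∘ xs))

∑-++ : ∀ (f : A → ℚ) xs ys → ∑ (xs ++ ys) f ≡ ∑ xs f + ∑ ys f
∑-++ f []       ys = sym (ℚ.+-identityˡ _)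
∑-++ f (x ∷ xs) ys = trans (cong (λ z → f x + z) (∑-++ f xs ys)) (sym (ℚ.+-assoc (f x) _ _))

∑-+ : ∀ (f g : A → ℚ) xs → ∑ xs (λ x → f x + g x) ≡ ∑ xs f + ∑ xs g
∑-+ f g []       = refl
∑-+ f g (x ∷ xs) = trans (cong (λ z → f x + g x + z) (∑-+ f g xs))
  (solve 4 (λ a b c d → (a :+ b) :+ (c :+ d) := (a :+ c) :+ (b :+ d)) refl (f x) (g x) (∑ xs f) (∑ xs g))

∑-*ˡ : ∀ c (f : A → ℚ) xs → ∑ xs (λ x → c * f x) ≡ c * ∑ xs f
∑-*ˡ c f []       = sym (ℚ.*-zeroʳ c)
∑-*ˡ c f (x ∷ xs) = trans (cong (λ z → c * f x + z) (∑-*ˡ c f xs)) (sym (ℚ.*-distribˡ-+ c (f x) _))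

∑-const : ∀ c (xs : List A) → ∑ xs (λ _ → c) ≡ c * ι (length xs)
∑-const c []       = sym (ℚ.*-zeroʳ c)
∑-const c (x ∷ xs) = begin
  c + ∑ xs (λ _ → c)             ≡⟨ cong (λ z → c + z) (∑-const c xs) ⟩
  c + c * ι (length xs)          ≡⟨ solve 2 (λ c l → c :+ c :* l := c :* (con 1ℚ :+ l)) refl c (ι (length xs)) ⟩
  c * (1ℚ + ι (length xs))       ≡⟨ cong (c *_) (ι-+ 1 (length xs)) ⟨
  c * ι (suc (length xs))        ∎

∑-upTo-cons : ∀ (f : ℕ → ℚ) n → ∑ (upTo (suc n)) f ≡ f 0 + ∑ (upTo n) (f ∘ suc)
∑-upTo-cons f n = cong sumℚ (trans (map-upTo f (suc n)) (cong (f 0 ∷_) (sym (map-upTo (f ∘ suc) n))))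

∑-upTo-snoc : ∀ (f : ℕ → ℚ) n → ∑ (upTo (suc n)) f ≡ ∑ (upTo n) f + f n
∑-upTo-snoc f n = begin
  ∑ (upTo (suc n)) f        ≡⟨ cong (λ xs → ∑ xs f) (upTo-∷ʳ n) ⟨
  ∑ (upTo n ++ n ∷ []) f    ≡⟨ ∑-++ f (upTo n) (n ∷ []) ⟩
  ∑ (upTo n) f + (f n + 0ℚ) ≡⟨ cong (λ z → ∑ (upTo n) f + z) (ℚ.+-identityʳ (f n)) ⟩
  ∑ (upTo n) f + f n        ∎

∑-upTo-cong : ∀ {f g : ℕ → ℚ} n → (∀ {k} → k < n → f k ≡ g k) → ∑ (upTo n) f ≡ ∑ (upTo n) g
∑-upTo-cong n f≗g = cong sumℚ (map-cong-local (All.map f≗g (all-upTo n)))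

-- Trades `Fin` indices for naturals, whose sums can be split at either end.
map-toℕ-allFin : ∀ (f : ℕ → A) n → map (f ∘ toℕ) (allFin n) ≡ map f (upTo n)
map-toℕ-allFin f n = trans (map-tabulate {n = n} id (f ∘ toℕ)) (trans (tabulate-toℕ f n) (sym (map-upTo f n)))
  where
  tabulate-toℕ : ∀ (f : ℕ → A) n → tabulate {n = n} (f ∘ toℕ) ≡ applyUpTo f n
  tabulate-toℕ f zero    = refl
  tabulate-toℕ f (suc n) = cong (f 0 ∷_) (tabulate-toℕ (f ∘ suc) n)

-- Expectations of two-stage and uniform choices.

-- Law of total expectation: the outer weight `w` factors out of the block of outcomes that it
-- scales.
𝔼->>= : ∀ (d : Dist A) (f : A → Dist B) (X : B → ℚ) → 𝔼 (d >>= f) X ≡ 𝔼 d (λ a → 𝔼 (f a) X)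
𝔼->>= []            f X = refl
𝔼->>= ((a , w) ∷ d) f X = begin
  𝔼 (map (λ (b , v) → b , w * v) (f a) ++ (d >>= f)) X
    ≡⟨ ∑-++ _ (map _ (f a)) (d >>= f) ⟩
  𝔼 (map (λ (b , v) → b , w * v) (f a)) X + 𝔼 (d >>= f) X
    ≡⟨ cong₂ _+_ (∑-map _ _ (f a)) (𝔼->>= d f X) ⟩
  ∑ (f a) (λ (b , v) → w * v * X b) + 𝔼 d (λ a → 𝔼 (f a) X)
    ≡⟨ cong (_+ _) (∑-cong (λ (b , v) → ℚ.*-assoc w v (X b)) (f a)) ⟩
  ∑ (f a) (λ (b , v) → w * (v * X b)) + 𝔼 d (λ a → 𝔼 (f a) X)
    ≡⟨ cong (_+ _) (∑-*ˡ w _ (f a)) ⟩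
  w * 𝔼 (f a) X + 𝔼 d (λ a → 𝔼 (f a) X) ∎

𝔼-uniform : ∀ (xs : List A) .{{_ : NonZero (length xs)}} X →
            𝔼 (uniform xs) X ≡ (+ 1 / length xs) * ∑ xs X
𝔼-uniform xs X = trans (∑-map _ _ xs) (∑-*ˡ (+ 1 / length xs) X xs)

-- Absorption identities for binomial coefficients.

-- Induction through Pascal's rule, applied to both rows. The identity will give the probability
-- `suc k / suc n` that the first step goes down.
C-absorb-suc : ∀ n k → suc k *ⁿ (suc n C suc k) ≡ suc n *ⁿ (n C k)
C-absorb-suc n       zero    =
  trans (ℕ.*-identityˡ _) (trans (nC1≡n (suc n)) (sym (ℕ.*-identityʳ (suc n))))
C-absorb-suc zero    (suc k) =
  trans (cong (suc (suc k) *ⁿ_) (k>n⇒nCk≡0 {1} {suc (suc k)} (ℕ.m≤m+n 2 k))) (ℕ.*-zeroʳ (suc (suc k)))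
C-absorb-suc (suc n) (suc k) = begin
  suc (suc k) *ⁿ (suc (suc n) C suc (suc k))
    ≡⟨ cong (suc (suc k) *ⁿ_) (nCk+nC[k+1]≡[n+1]C[k+1] (suc n) (suc k)) ⟨
  suc (suc k) *ⁿ (c +ⁿ (suc n C suc (suc k)))
    ≡⟨ ℕ.*-distribˡ-+ (suc (suc k)) c _ ⟩
  c +ⁿ suc k *ⁿ c +ⁿ suc (suc k) *ⁿ (suc n C suc (suc k))
    ≡⟨ cong₂ (λ a b → c +ⁿ a +ⁿ b) (C-absorb-suc n k) (C-absorb-suc n (suc k)) ⟩
  c +ⁿ suc n *ⁿ (n C k) +ⁿ suc n *ⁿ (n C suc k)
    ≡⟨ ℕ.+-assoc c _ _ ⟩
  c +ⁿ (suc n *ⁿ (n C k) +ⁿ suc n *ⁿ (n C suc k))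
    ≡⟨ cong (c +ⁿ_) (ℕ.*-distribˡ-+ (suc n) (n C k) _) ⟨
  c +ⁿ suc n *ⁿ ((n C k) +ⁿ (n C suc k))
    ≡⟨ cong (λ z → c +ⁿ suc n *ⁿ z) (nCk+nC[k+1]≡[n+1]C[k+1] n k) ⟩
  suc (suc n) *ⁿ c ∎
  where c = suc n C suc k

-- The complementary identity, for a first step up: subtract `C-absorb-suc` from Pascal's rule. Past
-- the end of the row, truncated subtraction and the binomial coefficient both give 0.
C-absorb : ∀ n k → (suc n ∸ k) *ⁿ (suc n C k) ≡ suc n *ⁿ (n C k)
C-absorb n zero = refl
C-absorb n (suc k) with k ℕ.≤? n
... | no k≰n = trans (cong (_*ⁿ (suc n C suc k)) (ℕ.m≤n⇒m∸n≡0 n≤k))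
                 (sym (trans (cong (suc n *ⁿ_) (k>n⇒nCk≡0 (ℕ.m<n⇒m<1+n (ℕ.≰⇒> k≰n)))) (ℕ.*-zeroʳ (suc n))))
  where n≤k = ℕ.<⇒≤ (ℕ.≰⇒> k≰n)
... | yes k≤n = ℕ.+-cancelˡ-≡ (suc k *ⁿ c) _ _ (begin
  suc k *ⁿ c +ⁿ (n ∸ k) *ⁿ c                  ≡⟨ ℕ.*-distribʳ-+ c (suc k) (n ∸ k) ⟨
  suc (k +ⁿ (n ∸ k)) *ⁿ c                     ≡⟨ cong (λ z → suc z *ⁿ c) (ℕ.m+[n∸m]≡n k≤n) ⟩
  suc n *ⁿ c                                  ≡⟨ cong (suc n *ⁿ_) (nCk+nC[k+1]≡[n+1]C[k+1] n k) ⟨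
  suc n *ⁿ ((n C k) +ⁿ (n C suc k))           ≡⟨ ℕ.*-distribˡ-+ (suc n) (n C k) _ ⟩
  suc n *ⁿ (n C k) +ⁿ suc n *ⁿ (n C suc k)    ≡⟨ cong (_+ⁿ suc n *ⁿ (n C suc k)) (C-absorb-suc n k) ⟨
  suc k *ⁿ c +ⁿ suc n *ⁿ (n C suc k)          ∎)
  where c = suc n C suc k

-- Paths decomposed by their first step.

filter-map : ∀ {p} {P : Pred B p} (P? : Decidable P) (f : A → B) xs →
             filter P? (map f xs) ≡ map f (filter (P? ∘ f) xs)
filter-map P? f []       = refl
filter-map P? f (x ∷ xs) with does (P? (f x))
... | true  = cong (f x ∷_) (filter-map P? f xs)
... | false = filter-map P? f xs

pathsBetween-refl : ∀ p → pathsBetween 0 p p ≡ (p ∷ []) ∷ []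
pathsBetween-refl p = filter-accept (λ P → last P ≟ᵖ p) refl

pathsBetween-zero : ∀ p q → p ≢ q → pathsBetween 0 p q ≡ []
pathsBetween-zero p q p≢q = filter-reject (λ P → last P ≟ᵖ q) {p ∷ []} {[]} p≢q

-- Since `last (p ∷ P)` reduces to `last P`, the end point test passes through the prepending of
-- `p`.
pathsBetween-suc : ∀ n p q →
  pathsBetween (suc n) p q ≡ map (p ∷_) (pathsBetween n (up p) q ++ pathsBetween n (down p) q)
pathsBetween-suc n p q = trans (filter-map to-q? (p ∷_) (pathsFrom n (up p) ++ pathsFrom n (down p)))
  (cong (map (p ∷_)) (filter-++ (λ P → last P ≟ᵖ q) (pathsFrom n (up p)) (pathsFrom n (down p))))
  where
  to-q? : Decidable (λ P → last P ≡ q)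
  to-q? P = last P ≟ᵖ q

-- Uses `does`, as `count` does, so that one case split reduces both in `zeros-∷`.
δ : ℤ → ℚ
δ y = if does (y ℤ.≟ 0ℤ) then 1ℚ else 0ℚ

zeros-∷ : ∀ {n} p (P : Path n) → ι (zeros (p ∷ P)) ≡ δ (proj₂ p) + ι (zeros P)
zeros-∷ p P with does (proj₂ p ℤ.≟ 0ℤ)
... | true  = ι-+ 1 (zeros P)
... | false = sym (ℚ.+-identityˡ _)

length-pathsBetween-suc : ∀ n p q → length (pathsBetween (suc n) p q) ≡
  length (pathsBetween n (up p) q) +ⁿ length (pathsBetween n (down p) q)
length-pathsBetween-suc n p q = begin
  length (pathsBetween (suc n) p q)  ≡⟨ cong length (pathsBetween-suc n p q) ⟩
  length (map (p ∷_) (U ++ D))       ≡⟨ length-map (p ∷_) (U ++ D) ⟩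
  length (U ++ D)                    ≡⟨ length-++ U ⟩
  length U +ⁿ length D               ∎
  where
  U = pathsBetween n (up p) q
  D = pathsBetween n (down p) q

-- The starting point lies on every path, so it contributes `δ` once per path; all other zeros lie
-- on the tails.
∑-zeros-suc : ∀ n p q → ∑ (pathsBetween (suc n) p q) (ι ∘ zeros) ≡
  δ (proj₂ p) * ι (length (pathsBetween (suc n) p q)) +
  (∑ (pathsBetween n (up p) q) (ι ∘ zeros) + ∑ (pathsBetween n (down p) q) (ι ∘ zeros))
∑-zeros-suc n p q = begin
  ∑ (pathsBetween (suc n) p q) (ι ∘ zeros)
    ≡⟨ cong (λ Ps → ∑ Ps (ι ∘ zeros)) (pathsBetween-suc n p q) ⟩
  ∑ (map (p ∷_) (U ++ D)) (ι ∘ zeros)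
    ≡⟨ ∑-map (p ∷_) (ι ∘ zeros) (U ++ D) ⟩
  ∑ (U ++ D) (λ P → ι (zeros (p ∷ P)))
    ≡⟨ ∑-cong (zeros-∷ p) (U ++ D) ⟩
  ∑ (U ++ D) (λ P → δ (proj₂ p) + ι (zeros P))
    ≡⟨ ∑-+ (λ _ → δ (proj₂ p)) (ι ∘ zeros) (U ++ D) ⟩
  ∑ (U ++ D) (λ _ → δ (proj₂ p)) + ∑ (U ++ D) (ι ∘ zeros)
    ≡⟨ cong₂ _+_ (∑-const (δ (proj₂ p)) (U ++ D)) (∑-++ (ι ∘ zeros) U D) ⟩
  δ (proj₂ p) * ι (length (U ++ D)) + (∑ U (ι ∘ zeros) + ∑ D (ι ∘ zeros))
    ≡⟨ cong (λ l → δ (proj₂ p) * ι l + (∑ U (ι ∘ zeros) + ∑ D (ι ∘ zeros)))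
         (trans (length-++ U) (sym (length-pathsBetween-suc n p q))) ⟩
  δ (proj₂ p) * ι (length (pathsBetween (suc n) p q)) + (∑ U (ι ∘ zeros) + ∑ D (ι ∘ zeros)) ∎
  where
  U = pathsBetween n (up p) q
  D = pathsBetween n (down p) q

-- Starting heights and the number of paths.

-- Reduces to the same term as `startHeight` at `toℕ k`, but leaves `k` unbounded for the
-- inductions.
height : ℕ → ℕ → ℤ
height n k = -ᶻ (+ n) +ᶻ + (2 *ⁿ k)

-- `k` is the number of down steps still to be made: an up step keeps it, a down step lowers it by
-- one.
height-up : ∀ n k → height (suc n) k +ᶻ 1ℤ ≡ height n k
height-up n k = identity (+ n) (+ (2 *ⁿ k))
  where
  identity : ∀ m j → -ᶻ (1ℤ +ᶻ m) +ᶻ j +ᶻ 1ℤ ≡ -ᶻ m +ᶻ j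
  identity = ℤ-solver.solve-∀

height-down : ∀ n k → height (suc n) (suc k) +ᶻ -1ℤ ≡ height n k
height-down n k = identity (+ n) (+ k)
  where
  identity : ∀ m j → -ᶻ (1ℤ +ᶻ m) +ᶻ ((1ℤ +ᶻ j) +ᶻ ((1ℤ +ᶻ j) +ᶻ 0ℤ)) +ᶻ -1ℤ ≡ -ᶻ m +ᶻ (j +ᶻ (j +ᶻ 0ℤ))
  identity = ℤ-solver.solve-∀

abscissa-suc : ∀ n x {z} → z ≡ x +ᶻ + suc n → z ≡ (x +ᶻ 1ℤ) +ᶻ + n
abscissa-suc n x z≡ = trans z≡ (identity x (+ n))
  where
  identity : ∀ x m → x +ᶻ (1ℤ +ᶻ m) ≡ (x +ᶻ 1ℤ) +ᶻ m
  identity = ℤ-solver.solve-∀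

-- From below `-n`, not even n up steps reach 0. Relative to this bound, an up step keeps the depth
-- and a down step adds two.
pathsBetween-below : ∀ n j {x y z} → y ≡ -ᶻ (+ n) +ᶻ -[1+ j ] → pathsBetween n (x , y) (z , 0ℤ) ≡ []
pathsBetween-below zero    j {x} {y} {z} refl = pathsBetween-zero (x , y) (z , 0ℤ) λ ()
pathsBetween-below (suc n) j {x} {y} {z} y≡ = trans (pathsBetween-suc n (x , y) (z , 0ℤ))
  (cong (map ((x , y) ∷_)) (cong₂ _++_
    (pathsBetween-below n j (trans (cong (_+ᶻ 1ℤ) y≡) (up-identity (+ n) -[1+ j ])))
    -- `suc (j +ⁿ 1)` is the index to which `-[1+ j ] +ᶻ -[1+ 1 ]` reduces.
    (pathsBetween-below n (suc (j +ⁿ 1)) (trans (cong (_+ᶻ -1ℤ) y≡) (down-identity (+ n) -[1+ j ])))))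
  where
  up-identity : ∀ m i → -ᶻ (1ℤ +ᶻ m) +ᶻ i +ᶻ 1ℤ ≡ -ᶻ m +ᶻ i
  up-identity = ℤ-solver.solve-∀
  down-identity : ∀ m i → -ᶻ (1ℤ +ᶻ m) +ᶻ i +ᶻ -1ℤ ≡ -ᶻ m +ᶻ (i +ᶻ -[1+ 1 ])
  down-identity = ℤ-solver.solve-∀

pathsBetween-lowest-down : ∀ n {x z} → pathsBetween n (x , height (suc n) 0 +ᶻ -1ℤ) (z , 0ℤ) ≡ []
pathsBetween-lowest-down n = pathsBetween-below n 1 (identity (+ n))
  where
  identity : ∀ m → -ᶻ (1ℤ +ᶻ m) +ᶻ 0ℤ +ᶻ -1ℤ ≡ -ᶻ m +ᶻ -[1+ 1 ]
  identity = ℤ-solver.solve-∀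

-- Pascal's rule, split by the first step. The up branch from `k = suc n` leaves the range `k ≤ n`,
-- so all `k` are covered: beyond the range both sides are 0.
length-pathsBetween : ∀ n k {x y z} → z ≡ x +ᶻ + n → y ≡ height n k →
                      length (pathsBetween n (x , y) (z , 0ℤ)) ≡ n C k
length-pathsBetween zero zero {x} refl refl rewrite ℤ.+-identityʳ x = cong length (pathsBetween-refl (x , 0ℤ))
length-pathsBetween zero (suc k) {x} {y} {z} z≡ refl =
  cong length (pathsBetween-zero (x , y) (z , 0ℤ) λ ())
length-pathsBetween (suc n) zero {x} {z = z} z≡ refl = begin
  length (pathsBetween (suc n) (x , height (suc n) 0) (z , 0ℤ))
    ≡⟨ length-pathsBetween-suc n (x , height (suc n) 0) (z , 0ℤ) ⟩
  _ ≡⟨ cong₂ _+ⁿ_ (length-pathsBetween n 0 (abscissa-suc n x z≡) (height-up n 0))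
                  (cong length (pathsBetween-lowest-down n)) ⟩
  (n C 0) +ⁿ 0 ∎
length-pathsBetween (suc n) (suc k) {x} {z = z} z≡ refl = begin
  length (pathsBetween (suc n) (x , height (suc n) (suc k)) (z , 0ℤ))
    ≡⟨ length-pathsBetween-suc n (x , height (suc n) (suc k)) (z , 0ℤ) ⟩
  _ ≡⟨ cong₂ _+ⁿ_ (length-pathsBetween n (suc k) (abscissa-suc n x z≡) (height-up n (suc k)))
                  (length-pathsBetween n k (abscissa-suc n x z≡) (height-down n k)) ⟩
  (n C suc k) +ⁿ (n C k) ≡⟨ ℕ.+-comm (n C suc k) (n C k) ⟩
  (n C k) +ⁿ (n C suc k) ≡⟨ nCk+nC[k+1]≡[n+1]C[k+1] n k ⟩
  suc n C suc k ∎

-- Mean number of zeros from a given starting height.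

-- At k = 0 the junk value pred 0 = 0 is harmless, as its coefficient vanishes.
meanZeros : ℕ → ℕ → ℚ
meanZeros zero    k = 1ℚ
meanZeros (suc n) k =
  (+ 1 / suc n) * (ι (suc n ∸ k) * meanZeros n k + ι k * meanZeros n (pred k)) + δ (height (suc n) k)

-- From sums over paths to means: of `c` paths, `a` start upwards with mean `u` and `b` downwards
-- with mean `v`; the probabilities are `s / m` and `t / m`, and `d` counts the starting point.
weighted-mean : ∀ r m s t c a b u v d → r * m ≡ 1ℚ → s * c ≡ m * a → t * c ≡ m * b →
                d * c + (a * u + b * v) ≡ c * (r * (s * u + t * v) + d)
weighted-mean r m s t c a b u v d rm≡1 sc≡ma tc≡mb = sym (begin
  c * (r * (s * u + t * v) + d)
    ≡⟨ solve 7 (λ r s t c u v d → c :* (r :* (s :* u :+ t :* v) :+ d) :=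
                                  d :* c :+ r :* (s :* c :* u :+ t :* c :* v)) refl r s t c u v d ⟩
  d * c + r * (s * c * u + t * c * v)
    ≡⟨ cong₂ (λ a′ b′ → d * c + r * (a′ * u + b′ * v)) sc≡ma tc≡mb ⟩
  d * c + r * (m * a * u + m * b * v)
    ≡⟨ solve 7 (λ r m a b u v e → e :+ r :* (m :* a :* u :+ m :* b :* v) :=
                                  e :+ r :* m :* (a :* u :+ b :* v)) refl r m a b u v (d * c) ⟩
  d * c + r * m * (a * u + b * v)
    ≡⟨ cong (λ z → d * c + z * (a * u + b * v)) rm≡1 ⟩
  d * c + 1ℚ * (a * u + b * v)
    ≡⟨ cong (λ z → d * c + z) (ℚ.*-identityˡ _) ⟩
  d * c + (a * u + b * v) ∎)

ι-cong-* : ∀ a b c d → a *ⁿ b ≡ c *ⁿ d → ι a * ι b ≡ ι c * ι d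
ι-cong-* a b c d eq = trans (sym (ι-* a b)) (trans (cong ι eq) (ι-* c d))

-- Number times mean, instead of a quotient, keeps the claim meaningful for `k > n`, where there are
-- no paths.
∑-zeros-pathsBetween : ∀ n k {x y z} → z ≡ x +ᶻ + n → y ≡ height n k →
                       ∑ (pathsBetween n (x , y) (z , 0ℤ)) (ι ∘ zeros) ≡ ι (n C k) * meanZeros n k
∑-zeros-pathsBetween zero zero {x} refl refl rewrite ℤ.+-identityʳ x =
  cong (λ Ps → ∑ Ps (ι ∘ zeros)) (pathsBetween-refl (x , 0ℤ))
∑-zeros-pathsBetween zero (suc k) {x} {y} {z} z≡ refl =
  cong (λ Ps → ∑ Ps (ι ∘ zeros)) (pathsBetween-zero (x , y) (z , 0ℤ) λ ())
∑-zeros-pathsBetween (suc n) zero {x} {y} {z} z≡ refl = begin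
  ∑ (pathsBetween (suc n) (x , y) (z , 0ℤ)) (ι ∘ zeros)
    ≡⟨ ∑-zeros-suc n (x , y) (z , 0ℤ) ⟩
  _ ≡⟨ cong₂ (λ l s → δ y * ι l + s) (length-pathsBetween (suc n) 0 z≡ refl)
         (cong₂ _+_ (∑-zeros-pathsBetween n 0 (abscissa-suc n x z≡) (height-up n 0))
                    -- The empty down branch gives 0, written as a multiple of `meanZeros n 0` to
                    -- fit the junk term of `meanZeros (suc n) 0`, whose coefficient is `ι 0`.
                    (trans (cong (λ Ps → ∑ Ps (ι ∘ zeros)) (pathsBetween-lowest-down n))
                           (sym (ℚ.*-zeroˡ (meanZeros n 0))))) ⟩
  δ y * ι (suc n C 0) + (ι (n C 0) * meanZeros n 0 + 0ℚ * meanZeros n 0)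
    ≡⟨ weighted-mean (+ 1 / suc n) (ι (suc n)) (ι (suc n)) (ι 0) (ι (suc n C 0)) (ι (n C 0)) 0ℚ
         (meanZeros n 0) (meanZeros n 0) (δ y) (1/n*n≡1 (suc n))
         refl (sym (ℚ.*-zeroʳ (ι (suc n)))) ⟩
  ι (suc n C 0) * meanZeros (suc n) 0 ∎
∑-zeros-pathsBetween (suc n) (suc k) {x} {y} {z} z≡ refl = begin
  ∑ (pathsBetween (suc n) (x , y) (z , 0ℤ)) (ι ∘ zeros)
    ≡⟨ ∑-zeros-suc n (x , y) (z , 0ℤ) ⟩
  _ ≡⟨ cong₂ (λ l s → δ y * ι l + s) (length-pathsBetween (suc n) (suc k) z≡ refl)
         (cong₂ _+_ (∑-zeros-pathsBetween n (suc k) (abscissa-suc n x z≡) (height-up n (suc k)))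
                    (∑-zeros-pathsBetween n k (abscissa-suc n x z≡) (height-down n k))) ⟩
  δ y * ι (suc n C suc k) + (ι (n C suc k) * meanZeros n (suc k) + ι (n C k) * meanZeros n k)
    ≡⟨ weighted-mean (+ 1 / suc n) (ι (suc n)) (ι (n ∸ k)) (ι (suc k)) (ι (suc n C suc k)) (ι (n C suc k)) (ι (n C k))
         (meanZeros n (suc k)) (meanZeros n k) (δ y) (1/n*n≡1 (suc n))
         -- Absorption supplies the first-step probabilities: up `(n ∸ k) / suc n`, down
         -- `suc k / suc n`.
         (ι-cong-* (n ∸ k) (suc n C suc k) (suc n) (n C suc k) (C-absorb n (suc k)))
         (ι-cong-* (suc k) (suc n C suc k) (suc n) (n C k) (C-absorb-suc n k)) ⟩
  ι (suc n C suc k) * meanZeros (suc n) (suc k) ∎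

𝔼-zeros-paths : ∀ n k → 𝔼 (uniform (paths n k) {{paths-nonZero n k}}) (ι ∘ zeros) ≡ meanZeros n (toℕ k)
𝔼-zeros-paths n k = begin
  𝔼 (uniform (paths n k)) (ι ∘ zeros)
    ≡⟨ 𝔼-uniform (paths n k) (ι ∘ zeros) ⟩
  (+ 1 / l) * ∑ (paths n k) (ι ∘ zeros)
    ≡⟨ cong (λ z → (+ 1 / l) * z) (∑-zeros-pathsBetween n (toℕ k) n≡0+n refl) ⟩
  (+ 1 / l) * (ι (n C toℕ k) * meanZeros n (toℕ k))
    -- The binomial coefficient is the number `l` of paths, so it cancels against the uniform
    -- weight.
    ≡⟨ cong (λ c → (+ 1 / l) * (ι c * meanZeros n (toℕ k))) (length-pathsBetween n (toℕ k) n≡0+n refl) ⟨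
  (+ 1 / l) * (ι l * meanZeros n (toℕ k))
    ≡⟨ ℚ.*-assoc (+ 1 / l) (ι l) _ ⟨
  (+ 1 / l) * ι l * meanZeros n (toℕ k)
    ≡⟨ cong (_* meanZeros n (toℕ k)) (1/n*n≡1 l) ⟩
  1ℚ * meanZeros n (toℕ k)
    ≡⟨ ℚ.*-identityˡ _ ⟩
  meanZeros n (toℕ k) ∎
  where
  l = length (paths n k)
  instance _ = paths-nonZero n k
  n≡0+n : + n ≡ 0ℤ +ᶻ + n
  n≡0+n = sym (ℤ.+-identityˡ (+ n))

-- Averaging over the starting heights.

𝔼-zeros-randomPath : ∀ n → 𝔼 (randomPath n) (ι ∘ zeros) ≡ (+ 1 / suc n) * ∑ (upTo (suc n)) (meanZeros n)
𝔼-zeros-randomPath n = begin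
  𝔼 (randomPath n) (ι ∘ zeros)
    ≡⟨ 𝔼->>= (uniform (allFin (suc n))) (λ k → uniform (paths n k) {{paths-nonZero n k}}) (ι ∘ zeros) ⟩
  𝔼 (uniform (allFin (suc n))) (λ k → 𝔼 (uniform (paths n k) {{paths-nonZero n k}}) (ι ∘ zeros))
    ≡⟨ 𝔼-uniform (allFin (suc n)) _ ⟩
  (+ 1 / length (allFin (suc n))) *
    ∑ (allFin (suc n)) (λ k → 𝔼 (uniform (paths n k) {{paths-nonZero n k}}) (ι ∘ zeros))
    ≡⟨ cong₂ _*_ (ℚ./-cong {+ 1} refl (length-tabulate {n = suc n} id)) (∑-cong (𝔼-zeros-paths n) (allFin (suc n))) ⟩
  (+ 1 / suc n) * ∑ (allFin (suc n)) (meanZeros n ∘ toℕ)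
    ≡⟨ cong (λ xs → (+ 1 / suc n) * sumℚ xs) (map-toℕ-allFin (meanZeros n) (suc n)) ⟩
  (+ 1 / suc n) * ∑ (upTo (suc n)) (meanZeros n) ∎

-- The sum of the indicators `[2k = n]`: 1 for even n, 0 for odd n.
centres : ℕ → ℚ
centres n = ∑ (upTo (suc n)) (δ ∘ height n)

∑-meanZeros-suc : ∀ n → ∑ (upTo (suc (suc n))) (meanZeros (suc n)) ≡
  (+ 1 / suc n) * (ι (suc (suc n)) * ∑ (upTo (suc n)) (meanZeros n)) + centres (suc n)
∑-meanZeros-suc n = begin
  ∑ (upTo (suc (suc n))) (meanZeros (suc n))
    ≡⟨ ∑-+ (λ k → r * (f k + g k)) (δ ∘ height (suc n)) (upTo (suc (suc n))) ⟩
  ∑ (upTo (suc (suc n))) (λ k → r * (f k + g k)) + centres (suc n)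
    ≡⟨ cong (_+ centres (suc n)) (∑-*ˡ r (λ k → f k + g k) (upTo (suc (suc n)))) ⟩
  r * ∑ (upTo (suc (suc n))) (λ k → f k + g k) + centres (suc n)
    ≡⟨ cong (λ z → r * z + centres (suc n)) redistribute ⟩
  r * (ι (suc (suc n)) * ∑ (upTo (suc n)) e) + centres (suc n) ∎
  where
  r = + 1 / suc n
  e f g : ℕ → ℚ
  e = meanZeros n
  f k = ι (suc n ∸ k) * e k
  g k = ι k * e (pred k)

  -- The highest start `k = suc n` has no up step to take, so its coefficient vanishes.
  f-last : ∑ (upTo (suc (suc n))) f ≡ ∑ (upTo (suc n)) f
  f-last = begin
    ∑ (upTo (suc (suc n))) f
      ≡⟨ ∑-upTo-snoc f (suc n) ⟩
    ∑ (upTo (suc n)) f + ι (n ∸ n) * e (suc n)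
      ≡⟨ cong (λ z → ∑ (upTo (suc n)) f + ι z * e (suc n)) (ℕ.n∸n≡0 n) ⟩
    ∑ (upTo (suc n)) f + 0ℚ * e (suc n)
      ≡⟨ solve 2 (λ a b → a :+ con 0ℚ :* b := a) refl (∑ (upTo (suc n)) f) (e (suc n)) ⟩
    ∑ (upTo (suc n)) f ∎

  -- The lowest start `k = 0` has no down step to take. Dropping it shifts the index, which removes
  -- `pred`.
  g-first : ∑ (upTo (suc (suc n))) g ≡ ∑ (upTo (suc n)) (g ∘ suc)
  g-first = trans (∑-upTo-cons g (suc n))
    (solve 2 (λ a b → con 0ℚ :* b :+ a := a) refl (∑ (upTo (suc n)) (g ∘ suc)) (e 0))

  -- `e k` is entered upwards from `k` and downwards from `suc k`. The two weights add up to
  -- `suc (suc n)`, independently of `k`, so the sum over `k` closes up.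
  combine : ∀ {k} → k < suc n → f k + g (suc k) ≡ ι (suc (suc n)) * e k
  combine {k} k<1+n = begin
    ι (suc n ∸ k) * e k + ι (suc k) * e k  ≡⟨ ℚ.*-distribʳ-+ (e k) (ι (suc n ∸ k)) (ι (suc k)) ⟨
    (ι (suc n ∸ k) + ι (suc k)) * e k      ≡⟨ cong (_* e k) (ι-+ (suc n ∸ k) (suc k)) ⟨
    ι (suc n ∸ k +ⁿ suc k) * e k           ≡⟨ cong (λ m → ι m * e k) (ℕ.+-suc (suc n ∸ k) k) ⟩
    ι (suc (suc n ∸ k +ⁿ k)) * e k         ≡⟨ cong (λ m → ι (suc m) * e k) (ℕ.m∸n+n≡m (ℕ.<⇒≤ k<1+n)) ⟩
    ι (suc (suc n)) * e k                  ∎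

  redistribute : ∑ (upTo (suc (suc n))) (λ k → f k + g k) ≡ ι (suc (suc n)) * ∑ (upTo (suc n)) e
  redistribute = begin
    ∑ (upTo (suc (suc n))) (λ k → f k + g k)             ≡⟨ ∑-+ f g (upTo (suc (suc n))) ⟩
    ∑ (upTo (suc (suc n))) f + ∑ (upTo (suc (suc n))) g  ≡⟨ cong₂ _+_ f-last g-first ⟩
    ∑ (upTo (suc n)) f + ∑ (upTo (suc n)) (g ∘ suc)      ≡⟨ ∑-+ f (g ∘ suc) (upTo (suc n)) ⟨
    ∑ (upTo (suc n)) (λ k → f k + g (suc k))             ≡⟨ ∑-upTo-cong (suc n) combine ⟩
    ∑ (upTo (suc n)) (λ k → ι (suc (suc n)) * e k)       ≡⟨ ∑-*ˡ (ι (suc (suc n))) e (upTo (suc n)) ⟩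
    ι (suc (suc n)) * ∑ (upTo (suc n)) e                 ∎

-- Parity of the length and odd harmonic numbers.

-- The heights for n + 2 are those for n and the two extremes n + 2 and -(n + 2), where `δ`
-- vanishes.
centres-2+ : ∀ n → centres (suc (suc n)) ≡ centres n
centres-2+ n = begin
  centres (suc (suc n))
    ≡⟨ ∑-upTo-cons d (suc (suc n)) ⟩
  0ℚ + ∑ (upTo (suc (suc n))) (d ∘ suc)
    ≡⟨ ℚ.+-identityˡ _ ⟩
  ∑ (upTo (suc (suc n))) (d ∘ suc)
    ≡⟨ ∑-upTo-snoc (d ∘ suc) (suc n) ⟩
  ∑ (upTo (suc n)) (d ∘ suc) + d (suc (suc n))
    ≡⟨ cong₂ _+_ (∑-cong (λ k → cong δ (shift (+ n) (+ k))) (upTo (suc n))) (cong δ (top (+ suc (suc n)))) ⟩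
  centres n + 0ℚ
    ≡⟨ ℚ.+-identityʳ _ ⟩
  centres n ∎
  where
  d = δ ∘ height (suc (suc n))
  shift : ∀ m k → -ᶻ (+ 2 +ᶻ m) +ᶻ ((1ℤ +ᶻ k) +ᶻ ((1ℤ +ᶻ k) +ᶻ 0ℤ)) ≡ -ᶻ m +ᶻ (k +ᶻ (k +ᶻ 0ℤ))
  shift = ℤ-solver.solve-∀
  top : ∀ m → -ᶻ m +ᶻ (m +ᶻ (m +ᶻ 0ℤ)) ≡ m
  top = ℤ-solver.solve-∀

-- Both components have period two in n. Divisibility concerns `suc n` because index n stands for
-- the denominator n + 1 in `H-odd`.
centres-parity : ∀ n → (2 ∣ suc n × centres n ≡ 0ℚ) ⊎ (¬ 2 ∣ suc n × centres n ≡ 1ℚ)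
centres-parity 0 = inj₂ ((λ 2∣1 → contradiction (∣1⇒≡1 2∣1) λ ()) , refl)
centres-parity 1 = inj₁ (n∣n , refl)
centres-parity (suc (suc n)) with centres-parity n
... | inj₁ (2∣1+n , c≡0) = inj₁ (∣m∣n⇒∣m+n n∣n 2∣1+n , trans (centres-2+ n) c≡0)
... | inj₂ (2∤1+n , c≡1) = inj₂ ((λ 2∣3+n → 2∤1+n (∣m+n∣m⇒∣n 2∣3+n n∣n)) , trans (centres-2+ n) c≡1)

-- The new denominator n + 1 is odd exactly when n is even, which is when `centres n` is 1.
H-odd-suc : ∀ n → H-odd (suc n) ≡ H-odd n + centres n * (+ 1 / suc n)
H-odd-suc n = begin
  H-odd (suc n)
    ≡⟨ cong (λ is → ∑ (filter odd? is) recip) (upTo-∷ʳ n) ⟨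
  ∑ (filter odd? (upTo n ++ n ∷ [])) recip
    ≡⟨ cong (λ is → ∑ is recip) (filter-++ odd? (upTo n) (n ∷ [])) ⟩
  ∑ (filter odd? (upTo n) ++ filter odd? (n ∷ [])) recip
    ≡⟨ ∑-++ recip (filter odd? (upTo n)) (filter odd? (n ∷ [])) ⟩
  H-odd n + ∑ (filter odd? (n ∷ [])) recip
    ≡⟨ cong (λ z → H-odd n + z) (term (centres-parity n)) ⟩
  H-odd n + centres n * recip n ∎
  where
  odd? : Decidable (λ i → ¬ 2 ∣ suc i)
  odd? i = ¬? (2 ∣? suc i)
  recip : ℕ → ℚ
  recip i = + 1 / suc i
  term : (2 ∣ suc n × centres n ≡ 0ℚ) ⊎ (¬ 2 ∣ suc n × centres n ≡ 1ℚ) →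
         ∑ (filter odd? (n ∷ [])) recip ≡ centres n * recip n
  term (inj₁ (2∣1+n , c≡0)) = begin
    ∑ (filter odd? (n ∷ [])) recip  ≡⟨ cong (λ is → ∑ is recip) (filter-reject odd? (λ 2∤1+n → 2∤1+n 2∣1+n)) ⟩
    0ℚ                              ≡⟨ ℚ.*-zeroˡ (recip n) ⟨
    0ℚ * recip n                    ≡⟨ cong (_* recip n) c≡0 ⟨
    centres n * recip n             ∎
  term (inj₂ (2∤1+n , c≡1)) = begin
    ∑ (filter odd? (n ∷ [])) recip  ≡⟨ cong (λ is → ∑ is recip) (filter-accept odd? 2∤1+n) ⟩
    recip n + 0ℚ                    ≡⟨ ℚ.+-identityʳ (recip n) ⟩
    recip n                         ≡⟨ ℚ.*-identityˡ (recip n) ⟨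
    1ℚ * recip n                    ≡⟨ cong (_* recip n) c≡1 ⟨
    centres n * recip n             ∎

average-meanZeros : ∀ n → (+ 1 / suc n) * ∑ (upTo (suc n)) (meanZeros n) ≡ H-odd (suc n)
average-meanZeros zero    = refl
average-meanZeros (suc n) = begin
  r′ * ∑ (upTo (suc (suc n))) (meanZeros (suc n))
    ≡⟨ cong (λ z → r′ * z) (∑-meanZeros-suc n) ⟩
  r′ * (r * (ι (suc (suc n)) * S) + c)
    -- Regrouped so that `r′` cancels the factor n + 2 and `r * S` is the average for length n.
    ≡⟨ solve 5 (λ r r′ m s c → r′ :* (r :* (m :* s) :+ c) := r′ :* m :* (r :* s) :+ c :* r′)
         refl r r′ (ι (suc (suc n))) S c ⟩
  r′ * ι (suc (suc n)) * (r * S) + c * r′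
    ≡⟨ cong₂ (λ a b → a * b + c * r′) (1/n*n≡1 (suc (suc n))) (average-meanZeros n) ⟩
  1ℚ * H-odd (suc n) + c * r′
    ≡⟨ cong (_+ c * r′) (ℚ.*-identityˡ (H-odd (suc n))) ⟩
  H-odd (suc n) + c * r′
    ≡⟨ H-odd-suc (suc n) ⟨
  H-odd (suc (suc n)) ∎
  where
  r  = + 1 / suc n
  r′ = + 1 / suc (suc n)
  S  = ∑ (upTo (suc n)) (meanZeros n)
  c  = centres (suc n)

theorem4p1 : (n : ℕ) → 𝔼 (randomPath n) (λ P → + zeros P / 1) ≡ H-odd (suc n)
theorem4p1 n = trans (𝔼-zeros-randomPath n) (average-meanZeros n)
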